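{- Let $\mathcal{C}$ be a regular category and let $F:\mathcal{C}\to\mathcal{C}$ be an endofunctor which covers pullbacks. Then regular AM-bisimulations are closed under composition: for all $F$-coalgebras $\alpha:X\to FX$, $\beta:Y\to FY$, $\gamma:Z\to FZ$, if a relation $r$ from $X$ to $Y$ is a regular AM-bisimulation from $\alpha$ to $\beta$ and a relation $s$ from $Y$ to $Z$ is a regular AM-bisimulation from $\beta$ to $\gamma$, then the composite relation $r;s$ from $X$ to $Z$ is a regular AM-bisimulation from $\alpha$ to $\gamma$.
   Context: A relation from $X$ to $Y$ is a subobject of $X\times Y$, i.e. an equivalence class of monos $m:R\rightarrowtail X\times Y$ (two monos being equivalent if each factors through the other). $\pi_1,\pi_2$ denote the projections of a binary product. Composition of relations: if $r$ is represented by $m_r:R\rightarrowtail X\times Y$ and $s$ by $m_s:S\rightarrowtail Y\times Z$, let $\mu_1:R\star S\to R$, $\mu_2:R\star S\to S$ be the pullback of $\pi_2\cdot m_r:R\to Y$ and $\pi_1\cdot m_s:S\to Y$; then $r;s$ is the subobject of $X\times Z$ represented by the mono part of the (regular epi, mono)-factorisation of $\langle \pi_1\cdot m_r\cdot\mu_1,\ \pi_2\cdot m_s\cdot\mu_2\rangle:R\star S\to X\times Z$. An $F$-coalgebra is a morphism $\alpha:X\to FX$. Regular AM-bisimulation: a relation from $X$ to $Y$ is a regular AM-bisimulation from $\alpha:X\to FX$ to $\beta:Y\to FY$ if for any mono $r:R\rightarrowtail X\times Y$ representing it there is a mono $w:W\rightarrowtail FR\times R$ such that $\pi_2\cdot w:W\to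 R$ is a regular epi and $$(\alpha\times\beta)\cdot r\cdot\pi_2\cdot w=\langle F\pi_1,F\pi_2\rangle\cdot Fr\cdot\pi_1\cdot w : W\to FX\times FY .$$ $F$ covers pullbacks if, for every pullback $X\xleftarrow{u}R\xrightarrow{v}Y$ of a cospan $X\xrightarrow{f}Z\xleftarrow{g}Y$ and every pullback $FX\xleftarrow{u'}R'\xrightarrow{v'}FY$ of the cospan $FX\xrightarrow{Ff}FZ\xleftarrow{Fg}FY$, the unique morphism $c:FR\to R'$ with $u'\cdot c=Fu$ and $v'\cdot c=Fv$ is a regular epi. -}

module Defs where

open import Level using (Level; suc; _⊔_)
open import Data.Product using (Σ-syntax) renaming (_×_ to _∧_)
open import Relation.Binary.Core using (Rel)
open import Relation.Binary.Bundles using (Setoid)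
open import Relation.Binary.Structures using (IsEquivalence)
import Relation.Binary.Reasoning.Setoid as SetoidReasoning

-- Hom-sets are setoids, so "=" between morphisms is the hom-setoid equality _≈_.
record Category (o ℓ e : Level) : Set (suc (o ⊔ ℓ ⊔ e)) where
  infixr 9 _∘_
  infix  4 _≈_ _⇒_
  field
    Obj       : Set o
    _⇒_       : Obj → Obj → Set ℓ
    _≈_       : ∀ {A B} → Rel (A ⇒ B) e
    id        : ∀ {A} → A ⇒ A
    _∘_       : ∀ {A B C} → B ⇒ C → A ⇒ B → A ⇒ C
    equiv     : ∀ {A B} → IsEquivalence (_≈_ {A} {B})
    ∘-resp-≈  : ∀ {A B C} {f f′ : B ⇒ C} {g g′ : A ⇒ B} →
                f ≈ f′ → g ≈ g′ → f ∘ g ≈ f′ ∘ g′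
    assoc     : ∀ {A B C D} {f : A ⇒ B} {g : B ⇒ C} {h : C ⇒ D} →
                (h ∘ g) ∘ f ≈ h ∘ (g ∘ f)
    identityˡ : ∀ {A B} {f : A ⇒ B} → id ∘ f ≈ f
    identityʳ : ∀ {A B} {f : A ⇒ B} → f ∘ id ≈ f

  module ≈ {A B : Obj} = IsEquivalence (equiv {A} {B})

  hom-setoid : Obj → Obj → Setoid ℓ e
  hom-setoid A B = record { Carrier = A ⇒ B ; _≈_ = _≈_ ; isEquivalence = equiv }

  module ≈-Reasoning {A B : Obj} = SetoidReasoning (hom-setoid A B)

record Endofunctor {o ℓ e} (𝒞 : Category o ℓ e) : Set (o ⊔ ℓ ⊔ e) where
  open Category 𝒞
  field
    F₀           : Obj → Obj
    F₁           : ∀ {A B} → A ⇒ B → F₀ A ⇒ F₀ B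
    identity     : ∀ {A} → F₁ (id {A}) ≈ id
    homomorphism : ∀ {A B C} {f : A ⇒ B} {g : B ⇒ C} → F₁ (g ∘ f) ≈ F₁ g ∘ F₁ f
    F-resp-≈     : ∀ {A B} {f g : A ⇒ B} → f ≈ g → F₁ f ≈ F₁ g

module _ {o ℓ e} (𝒞 : Category o ℓ e) where
  open Category 𝒞

  record Terminal : Set (o ⊔ ℓ ⊔ e) where
    field
      ⊤        : Obj
      !        : ∀ {A} → A ⇒ ⊤
      !-unique : ∀ {A} (f : A ⇒ ⊤) → ! ≈ f

  record BinaryProducts : Set (o ⊔ ℓ ⊔ e) where
    infixr 7 _×_
    field
      _×_      : Obj → Obj → Obj
      π₁       : ∀ {A B} → A × B ⇒ A
      π₂       : ∀ {A B} → A × B ⇒ B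
      ⟨_,_⟩    : ∀ {A B C} → C ⇒ A → C ⇒ B → C ⇒ A × B
      project₁ : ∀ {A B C} {f : C ⇒ A} {g : C ⇒ B} → π₁ ∘ ⟨ f , g ⟩ ≈ f
      project₂ : ∀ {A B C} {f : C ⇒ A} {g : C ⇒ B} → π₂ ∘ ⟨ f , g ⟩ ≈ g
      unique   : ∀ {A B C} {f : C ⇒ A} {g : C ⇒ B} {h : C ⇒ A × B} →
                 π₁ ∘ h ≈ f → π₂ ∘ h ≈ g → ⟨ f , g ⟩ ≈ h

    infixr 8 _⁂_
    _⁂_ : ∀ {A B C D} → A ⇒ C → B ⇒ D → A × B ⇒ C × D
    f ⁂ g = ⟨ f ∘ π₁ , g ∘ π₂ ⟩

module _ {o ℓ e} {𝒞 : Category o ℓ e} where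
  open Category 𝒞

  record IsPullback {P X Y Z} (p₁ : P ⇒ X) (p₂ : P ⇒ Y) (f : X ⇒ Z) (g : Y ⇒ Z)
                    : Set (o ⊔ ℓ ⊔ e) where
    field
      commute      : f ∘ p₁ ≈ g ∘ p₂
      universal    : ∀ {A} {h₁ : A ⇒ X} {h₂ : A ⇒ Y} → f ∘ h₁ ≈ g ∘ h₂ → A ⇒ P
      p₁∘universal : ∀ {A} {h₁ : A ⇒ X} {h₂ : A ⇒ Y} (eq : f ∘ h₁ ≈ g ∘ h₂) →
                     p₁ ∘ universal eq ≈ h₁
      p₂∘universal : ∀ {A} {h₁ : A ⇒ X} {h₂ : A ⇒ Y} (eq : f ∘ h₁ ≈ g ∘ h₂) →
                     p₂ ∘ universal eq ≈ h₂
      unique       : ∀ {A} {h₁ : A ⇒ X} {h₂ : A ⇒ Y} (eq : f ∘ h₁ ≈ g ∘ h₂) {u : A ⇒ P} →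
                     p₁ ∘ u ≈ h₁ → p₂ ∘ u ≈ h₂ → u ≈ universal eq

  record Pullback {X Y Z} (f : X ⇒ Z) (g : Y ⇒ Z) : Set (o ⊔ ℓ ⊔ e) where
    field
      {P}        : Obj
      p₁         : P ⇒ X
      p₂         : P ⇒ Y
      isPullback : IsPullback p₁ p₂ f g
    open IsPullback isPullback public

  record IsCoequalizer {A B Q} (f g : A ⇒ B) (q : B ⇒ Q) : Set (o ⊔ ℓ ⊔ e) where
    field
      equality     : q ∘ f ≈ q ∘ g
      coequalize   : ∀ {T} {h : B ⇒ T} → h ∘ f ≈ h ∘ g → Q ⇒ T
      coequalize∘q : ∀ {T} {h : B ⇒ T} (eq : h ∘ f ≈ h ∘ g) → coequalize eq ∘ q ≈ h
      unique       : ∀ {T} {h : B ⇒ T} (eq : h ∘ f ≈ h ∘ g) {u : Q ⇒ T} →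
                     u ∘ q ≈ h → u ≈ coequalize eq

  record Coequalizer {A B} (f g : A ⇒ B) : Set (o ⊔ ℓ ⊔ e) where
    field
      {Q}           : Obj
      q             : B ⇒ Q
      isCoequalizer : IsCoequalizer f g q
    open IsCoequalizer isCoequalizer public

  Mono : ∀ {A B} → A ⇒ B → Set (o ⊔ ℓ ⊔ e)
  Mono {A} m = ∀ {T} (g h : T ⇒ A) → m ∘ g ≈ m ∘ h → g ≈ h

  record RegularEpi {B Q} (q : B ⇒ Q) : Set (o ⊔ ℓ ⊔ e) where
    field
      {A}           : Obj
      f g           : A ⇒ B
      isCoequalizer : IsCoequalizer f g q
    open IsCoequalizer isCoequalizer public

  record RegularEpiMonoFactorisation {A B} (f : A ⇒ B) : Set (o ⊔ ℓ ⊔ e) where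
    field
      {I}        : Obj
      epi        : A ⇒ I
      mono       : I ⇒ B
      regularEpi : RegularEpi epi
      isMono     : Mono mono
      factors    : mono ∘ epi ≈ f

  record Subobject (B : Obj) : Set (o ⊔ ℓ ⊔ e) where
    field
      {dom}  : Obj
      arr    : dom ⇒ B
      isMono : Mono arr

  infix 4 _≤ₛ_ _≈ₛ_
  _≤ₛ_ : ∀ {B} → Subobject B → Subobject B → Set (ℓ ⊔ e)
  m ≤ₛ n = Σ[ k ∈ Subobject.dom m ⇒ Subobject.dom n ] Subobject.arr n ∘ k ≈ Subobject.arr m

  -- `Subobject B` is the type of representing monos; equality of subobjects is this relation,
  -- and "m represents n" is m ≈ₛ n.
  _≈ₛ_ : ∀ {B} → Subobject B → Subobject B → Set (ℓ ⊔ e)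
  m ≈ₛ n = (m ≤ₛ n) ∧ (n ≤ₛ m)

  regularEpi⇒epi : ∀ {B Q} {q : B ⇒ Q} → RegularEpi q →
                   ∀ {T} {u v : Q ⇒ T} → u ∘ q ≈ v ∘ q → u ≈ v
  regularEpi⇒epi {q = q} re {u = u} {v} uq≈vq =
    ≈.trans (unique eq uq≈vq) (≈.sym (unique eq ≈.refl))
    where
    open RegularEpi re
    eq : (v ∘ q) ∘ f ≈ (v ∘ q) ∘ g
    eq = ≈.trans assoc (≈.trans (∘-resp-≈ ≈.refl equality) (≈.sym assoc))

-- Finite limits, coequalizers of kernel pairs, and pullback-stable regular epis.
record RegularCategory {o ℓ e} (𝒞 : Category o ℓ e) : Set (o ⊔ ℓ ⊔ e) where
  open Category 𝒞
  field
    terminal       : Terminal 𝒞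
    binaryProducts : BinaryProducts 𝒞
    pullback       : ∀ {X Y Z} (f : X ⇒ Z) (g : Y ⇒ Z) → Pullback {𝒞 = 𝒞} f g
    coequalizer    : ∀ {K X Y} {f : X ⇒ Y} {k₁ k₂ : K ⇒ X} →
                     IsPullback {𝒞 = 𝒞} k₁ k₂ f f → Coequalizer {𝒞 = 𝒞} k₁ k₂
    stable         : ∀ {P X Y Z} {p₁ : P ⇒ X} {p₂ : P ⇒ Y} {f : X ⇒ Z} {g : Y ⇒ Z} →
                     IsPullback {𝒞 = 𝒞} p₁ p₂ f g →
                     RegularEpi {𝒞 = 𝒞} f → RegularEpi {𝒞 = 𝒞} p₂

  open Terminal terminal public
  open BinaryProducts binaryProducts public

  factorise : ∀ {A B} (f : A ⇒ B) → RegularEpiMonoFactorisation {𝒞 = 𝒞} f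
  factorise {A} {B} f = record
    { epi        = q
    ; mono       = m
    ; regularEpi = q-regular
    ; isMono     = m-mono
    ; factors    = m∘q≈f
    }
    where
    module K = Pullback (pullback f f)
    open Coequalizer (coequalizer K.isPullback)

    q-regular : RegularEpi {𝒞 = 𝒞} q
    q-regular = record { f = K.p₁ ; g = K.p₂ ; isCoequalizer = isCoequalizer }

    m : Q ⇒ B
    m = coequalize K.commute

    m∘q≈f : m ∘ q ≈ f
    m∘q≈f = coequalize∘q K.commute

    -- Lift g and h along q after covering T by T₂ ↠ T₁ ↠ T; the lifts then have equal
    -- image under f, so they factor through its kernel pair and are identified by q.
    m-mono : Mono {𝒞 = 𝒞} m
    m-mono {T} g h mg≈mh =
      regularEpi⇒epi (stable P₁.isPullback q-regular)
        (regularEpi⇒epi (stable P₂.isPullback q-regular) on-T₂)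
      where
      open ≈-Reasoning
      module P₁ = Pullback (pullback q g)
      module P₂ = Pullback (pullback q (h ∘ P₁.p₂))

      a b : P₂.P ⇒ A
      a = P₁.p₁ ∘ P₂.p₂
      b = P₂.p₁

      qa : q ∘ a ≈ (g ∘ P₁.p₂) ∘ P₂.p₂
      qa = begin
        q ∘ (P₁.p₁ ∘ P₂.p₂)  ≈⟨ ≈.sym assoc ⟩
        (q ∘ P₁.p₁) ∘ P₂.p₂  ≈⟨ ∘-resp-≈ P₁.commute ≈.refl ⟩
        (g ∘ P₁.p₂) ∘ P₂.p₂  ∎

      qb : q ∘ b ≈ (h ∘ P₁.p₂) ∘ P₂.p₂
      qb = P₂.commute

      fa≈fb : f ∘ a ≈ f ∘ b
      fa≈fb = begin
        f ∘ a                     ≈⟨ ∘-resp-≈ (≈.sym m∘q≈f) ≈.refl ⟩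
        (m ∘ q) ∘ a               ≈⟨ assoc ⟩
        m ∘ (q ∘ a)               ≈⟨ ∘-resp-≈ ≈.refl (≈.trans qa assoc) ⟩
        m ∘ (g ∘ P₁.p₂ ∘ P₂.p₂)   ≈⟨ ≈.sym assoc ⟩
        (m ∘ g) ∘ P₁.p₂ ∘ P₂.p₂   ≈⟨ ∘-resp-≈ mg≈mh ≈.refl ⟩
        (m ∘ h) ∘ P₁.p₂ ∘ P₂.p₂   ≈⟨ assoc ⟩
        m ∘ (h ∘ P₁.p₂ ∘ P₂.p₂)   ≈⟨ ∘-resp-≈ ≈.refl (≈.sym (≈.trans qb assoc)) ⟩
        m ∘ (q ∘ b)               ≈⟨ ≈.sym assoc ⟩
        (m ∘ q) ∘ b               ≈⟨ ∘-resp-≈ m∘q≈f ≈.refl ⟩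
        f ∘ b                     ∎

      k : P₂.P ⇒ K.P
      k = K.universal fa≈fb

      on-T₂ : (g ∘ P₁.p₂) ∘ P₂.p₂ ≈ (h ∘ P₁.p₂) ∘ P₂.p₂
      on-T₂ = begin
        (g ∘ P₁.p₂) ∘ P₂.p₂  ≈⟨ ≈.sym qa ⟩
        q ∘ a                ≈⟨ ∘-resp-≈ ≈.refl (≈.sym (K.p₁∘universal fa≈fb)) ⟩
        q ∘ (K.p₁ ∘ k)       ≈⟨ ≈.sym assoc ⟩
        (q ∘ K.p₁) ∘ k       ≈⟨ ∘-resp-≈ equality ≈.refl ⟩
        (q ∘ K.p₂) ∘ k       ≈⟨ assoc ⟩
        q ∘ (K.p₂ ∘ k)       ≈⟨ ∘-resp-≈ ≈.refl (K.p₂∘universal fa≈fb) ⟩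
        q ∘ b                ≈⟨ qb ⟩
        (h ∘ P₁.p₂) ∘ P₂.p₂  ∎

  Relation : Obj → Obj → Set (o ⊔ ℓ ⊔ e)
  Relation X Y = Subobject {𝒞 = 𝒞} (X × Y)

  infixl 6 _⨾_
  _⨾_ : ∀ {X Y Z} → Relation X Y → Relation Y Z → Relation X Z
  r ⨾ s = record { arr = I.mono ; isMono = I.isMono }
    where
    module r = Subobject r
    module s = Subobject s
    open Pullback (pullback (π₂ ∘ r.arr) (π₁ ∘ s.arr)) renaming (p₁ to μ₁; p₂ to μ₂)
    module I = RegularEpiMonoFactorisation
                 (factorise ⟨ π₁ ∘ r.arr ∘ μ₁ , π₂ ∘ s.arr ∘ μ₂ ⟩)

module _ {o ℓ e} {𝒞 : Category o ℓ e} (F : Endofunctor 𝒞) where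
  open Category 𝒞
  open Endofunctor F

  CoversPullbacks : Set (o ⊔ ℓ ⊔ e)
  CoversPullbacks =
    ∀ {X Y Z R R′} {f : X ⇒ Z} {g : Y ⇒ Z}
      {u : R ⇒ X} {v : R ⇒ Y} {u′ : R′ ⇒ F₀ X} {v′ : R′ ⇒ F₀ Y} →
    IsPullback {𝒞 = 𝒞} u v f g →
    IsPullback {𝒞 = 𝒞} u′ v′ (F₁ f) (F₁ g) →
    (c : F₀ R ⇒ R′) → u′ ∘ c ≈ F₁ u → v′ ∘ c ≈ F₁ v →
    RegularEpi {𝒞 = 𝒞} c

  Coalgebra : Obj → Set ℓ
  Coalgebra X = X ⇒ F₀ X

  module _ (reg : RegularCategory 𝒞) where
    open RegularCategory reg

    IsRegularAMBisimulation : ∀ {X Y} → Coalgebra X → Coalgebra Y → Relation X Y →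
                              Set (o ⊔ ℓ ⊔ e)
    IsRegularAMBisimulation {X} {Y} α β rel =
      (m : Relation X Y) → m ≈ₛ rel →
      let R = Subobject.dom m
          r = Subobject.arr m
      in Σ[ W ∈ Subobject {𝒞 = 𝒞} (F₀ R × R) ]
         let w = Subobject.arr W
         in RegularEpi {𝒞 = 𝒞} (π₂ ∘ w)
            ∧ (α ⁂ β) ∘ r ∘ π₂ ∘ w ≈ ⟨ F₁ π₁ , F₁ π₂ ⟩ ∘ F₁ r ∘ π₁ ∘ w

{-# OPTIONS --safe #-}

-- A relation is a regular AM-bisimulation as soon as some span FR ← V ↠ R, not necessarily jointly
-- monic, is compatible with the structures: its image in FR × R is then the required W.
-- For the composite, pull the two given covers back to a common cover V ↠ R ⋆ S.  The structure β
-- makes the two resulting maps V → FR and V → FS agree over FY, so V maps to the pullback of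
-- F(π₂ ∘ r) and F(π₁ ∘ s).  As F covers pullbacks, F(R ⋆ S) covers that pullback, hence over a further
-- cover V′ ↠ V this map lifts to F(R ⋆ S).
module Submission where

open import Level using (_⊔_)
open import Data.Product using (Σ-syntax; _,_) renaming (_×_ to _∧_)

open import Defs

-- Reassociation of composites.

module MorphismReasoning {o ℓ e} (𝒞 : Category o ℓ e) where
  open Category 𝒞

  ∘-resp-≈ˡ : ∀ {A B C} {f f′ : B ⇒ C} {g : A ⇒ B} → f ≈ f′ → f ∘ g ≈ f′ ∘ g
  ∘-resp-≈ˡ p = ∘-resp-≈ p ≈.refl

  ∘-resp-≈ʳ : ∀ {A B C} {f : B ⇒ C} {g g′ : A ⇒ B} → g ≈ g′ → f ∘ g ≈ f ∘ g′
  ∘-resp-≈ʳ p = ∘-resp-≈ ≈.refl p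

  pullˡ : ∀ {A B C D} {f : C ⇒ D} {g : B ⇒ C} {h : B ⇒ D} {k : A ⇒ B} →
          f ∘ g ≈ h → f ∘ g ∘ k ≈ h ∘ k
  pullˡ p = ≈.trans (≈.sym assoc) (∘-resp-≈ˡ p)

  pushˡ : ∀ {A B C D} {f : C ⇒ D} {g : B ⇒ C} {h : B ⇒ D} {k : A ⇒ B} →
          h ≈ f ∘ g → h ∘ k ≈ f ∘ g ∘ k
  pushˡ p = ≈.sym (pullˡ (≈.sym p))

  extendʳ : ∀ {A B C C′ D} {f : C ⇒ D} {g : B ⇒ C} {f′ : C′ ⇒ D} {g′ : B ⇒ C′} {k : A ⇒ B} →
            f ∘ g ≈ f′ ∘ g′ → f ∘ g ∘ k ≈ f′ ∘ g′ ∘ k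
  extendʳ p = ≈.trans (pullˡ p) assoc

-- Regular epimorphisms: isomorphism invariance, cancellation, diagonals, composition.

module RegularEpis {o ℓ e} {𝒞 : Category o ℓ e} where
  open Category 𝒞
  open MorphismReasoning 𝒞
  open ≈-Reasoning

  -- Cancelling the epi `q` in `d ∘ m ∘ q ≈ q` shows that `m` is an isomorphism with inverse `d`, so
  -- `q′` is a coequalizer of the same pair as `q`.
  regularEpi-retract : ∀ {A B B′} {q : A ⇒ B} {q′ : A ⇒ B′} {m : B ⇒ B′} {d : B′ ⇒ B} →
                       m ∘ d ≈ id → m ∘ q ≈ q′ → d ∘ q′ ≈ q →
                       RegularEpi {𝒞 = 𝒞} q → RegularEpi {𝒞 = 𝒞} q′
  regularEpi-retract {q = q} {q′} {m} {d} md mq dq′ re = record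
    { f = f
    ; g = g
    ; isCoequalizer = record
      { equality     = begin
          q′ ∘ f       ≈⟨ pushˡ (≈.sym mq) ⟩
          m ∘ q ∘ f    ≈⟨ ∘-resp-≈ʳ equality ⟩
          m ∘ q ∘ g    ≈⟨ pullˡ mq ⟩
          q′ ∘ g       ∎
      ; coequalize   = λ eq → coequalize eq ∘ d
      ; coequalize∘q = factor
      ; unique       = λ eq uq′≈h → cancel (≈.trans uq′≈h (≈.sym (factor eq)))
      }
    }
    where
    open RegularEpi re

    factor : ∀ {T} {h : _ ⇒ T} (eq : h ∘ f ≈ h ∘ g) → (coequalize eq ∘ d) ∘ q′ ≈ h
    factor eq = ≈.trans assoc (≈.trans (∘-resp-≈ʳ dq′) (coequalize∘q eq))

    cancel : ∀ {T} {u v : _ ⇒ T} → u ∘ q′ ≈ v ∘ q′ → u ≈ v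
    cancel {u = u} {v} p = begin
      u            ≈⟨ ≈.sym (retract u) ⟩
      (u ∘ m) ∘ d  ≈⟨ ∘-resp-≈ˡ (regularEpi⇒epi re um≈vm) ⟩
      (v ∘ m) ∘ d  ≈⟨ retract v ⟩
      v            ∎
      where
      retract : ∀ w → (w ∘ m) ∘ d ≈ w
      retract w = ≈.trans assoc (≈.trans (∘-resp-≈ʳ md) identityʳ)

      um≈vm : (u ∘ m) ∘ q ≈ (v ∘ m) ∘ q
      um≈vm = begin
        (u ∘ m) ∘ q  ≈⟨ assoc ⟩
        u ∘ m ∘ q    ≈⟨ ∘-resp-≈ʳ mq ⟩
        u ∘ q′       ≈⟨ p ⟩
        v ∘ q′       ≈⟨ ∘-resp-≈ʳ (≈.sym mq) ⟩
        v ∘ m ∘ q    ≈⟨ ≈.sym assoc ⟩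
        (v ∘ m) ∘ q  ∎

  -- Composing the pair coequalized by `q` with `p` gives a pair coequalized by `g`: if `h`
  -- identifies the new pair, `h ∘ p` factors through `q ≈ g ∘ p`, and the epi `p` cancels.
  regularEpi-cancel : ∀ {A B C} {q : A ⇒ C} {p : A ⇒ B} {g : B ⇒ C} →
                      (∀ {T} {u v : B ⇒ T} → u ∘ p ≈ v ∘ p → u ≈ v) → g ∘ p ≈ q →
                      RegularEpi {𝒞 = 𝒞} q → RegularEpi {𝒞 = 𝒞} g
  regularEpi-cancel {q = q} {p} {g} epi gp re = record
    { f = p ∘ re.f
    ; g = p ∘ re.g
    ; isCoequalizer = record
      { equality     = ≈.trans (pullˡ gp) (≈.trans re.equality (pushˡ (≈.sym gp)))
      ; coequalize   = λ eq → re.coequalize (precompose eq)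
      ; coequalize∘q = λ eq → epi (begin
          (re.coequalize (precompose eq) ∘ g) ∘ p  ≈⟨ assoc ⟩
          re.coequalize (precompose eq) ∘ g ∘ p    ≈⟨ ∘-resp-≈ʳ gp ⟩
          re.coequalize (precompose eq) ∘ q        ≈⟨ re.coequalize∘q (precompose eq) ⟩
          _ ∘ p                                    ∎)
      ; unique       = λ eq ug≈h → re.unique (precompose eq)
                         (≈.trans (∘-resp-≈ʳ (≈.sym gp)) (pullˡ ug≈h))
      }
    }
    where
    module re = RegularEpi re

    precompose : ∀ {T} {h : _ ⇒ T} → h ∘ p ∘ re.f ≈ h ∘ p ∘ re.g → (h ∘ p) ∘ re.f ≈ (h ∘ p) ∘ re.g
    precompose eq = ≈.trans assoc (≈.trans eq (≈.sym assoc))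

  -- Since `m` is mono, `u` identifies the pair that `q` coequalizes, and the induced map is the
  -- diagonal.
  regularEpi-diagonal : ∀ {A B C D} {q : A ⇒ B} {u : A ⇒ C} {v : B ⇒ D} {m : C ⇒ D} →
                        RegularEpi {𝒞 = 𝒞} q → Mono {𝒞 = 𝒞} m → m ∘ u ≈ v ∘ q →
                        Σ[ d ∈ B ⇒ C ] (d ∘ q ≈ u ∧ m ∘ d ≈ v)
  regularEpi-diagonal {q = q} {u} {v} {m} re mono mu≈vq =
    d , coequalize∘q uf≈ug , regularEpi⇒epi re (begin
      (m ∘ d) ∘ q  ≈⟨ assoc ⟩
      m ∘ d ∘ q    ≈⟨ ∘-resp-≈ʳ (coequalize∘q uf≈ug) ⟩
      m ∘ u        ≈⟨ mu≈vq ⟩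
      v ∘ q        ∎)
    where
    open RegularEpi re

    uf≈ug : u ∘ f ≈ u ∘ g
    uf≈ug = mono (u ∘ f) (u ∘ g) (begin
      m ∘ u ∘ f  ≈⟨ extendʳ mu≈vq ⟩
      v ∘ q ∘ f  ≈⟨ ∘-resp-≈ʳ equality ⟩
      v ∘ q ∘ g  ≈⟨ extendʳ (≈.sym mu≈vq) ⟩
      m ∘ u ∘ g  ∎)

    d : _ ⇒ _
    d = coequalize uf≈ug

  -- Diagonals against p and then q give a section of the mono part of q ∘ p.
  regularEpi-∘ : RegularCategory 𝒞 → ∀ {A B C} {q : B ⇒ C} {p : A ⇒ B} →
                 RegularEpi {𝒞 = 𝒞} q → RegularEpi {𝒞 = 𝒞} p → RegularEpi {𝒞 = 𝒞} (q ∘ p)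
  regularEpi-∘ reg {q = q} {p} req rep =
    let open RegularEpiMonoFactorisation (RegularCategory.factorise reg (q ∘ p))
        d  , dp≈e  , md≈q   = regularEpi-diagonal rep isMono factors
        d′ , d′q≈d , md′≈id = regularEpi-diagonal req isMono (≈.trans md≈q (≈.sym identityˡ))
    in regularEpi-retract md′≈id factors (≈.trans (pullˡ d′q≈d) dp≈e) regularEpi

  -- The comparison maps between equivalent monos are mutually inverse. This carries a regular epi
  -- onto one representative of a relation over to any other.
  regularEpi-≈ₛ : ∀ {A B} {m n : Subobject {𝒞 = 𝒞} B} {q : A ⇒ Subobject.dom n} →
                  ((k , _) : n ≤ₛ m) → m ≤ₛ n →
                  RegularEpi {𝒞 = 𝒞} q → RegularEpi {𝒞 = 𝒞} (k ∘ q)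
  regularEpi-≈ₛ {m = m} {n} {q} (k , mk≈n) (l , nl≈m) =
    regularEpi-retract
      (m.isMono _ _ (inverse mk≈n nl≈m))
      ≈.refl
      (≈.trans (pullˡ (n.isMono _ _ (inverse nl≈m mk≈n))) identityˡ)
    where
    module m = Subobject m
    module n = Subobject n

    inverse : ∀ {A B C} {m : A ⇒ C} {n : B ⇒ C} {k : B ⇒ A} {l : A ⇒ B} →
              m ∘ k ≈ n → n ∘ l ≈ m → m ∘ k ∘ l ≈ m ∘ id
    inverse mk≈n nl≈m = ≈.trans (pullˡ mk≈n) (≈.trans nl≈m (≈.sym identityʳ))

-- Spans compatible with coalgebra structures.

module Bisimulations {o ℓ e} {𝒞 : Category o ℓ e} (reg : RegularCategory 𝒞)
                     (F : Endofunctor 𝒞) where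
  open Category 𝒞
  open MorphismReasoning 𝒞
  open RegularEpis {𝒞 = 𝒞}
  open RegularCategory reg
  open Endofunctor F
  open ≈-Reasoning

  -- One component of the bisimulation equation. Treating the components separately lets `β` be met
  -- both as second component for `r` and as first component for `s`.
  Compatible : ∀ {X R V} → Coalgebra F X → R ⇒ X → V ⇒ F₀ R → V ⇒ R → Set e
  Compatible α f a b = F₁ f ∘ a ≈ α ∘ f ∘ b

  module _ {X R} {α : Coalgebra F X} {f : R ⇒ X} where

    Compatible-∘ : ∀ {V V′} {a : V ⇒ F₀ R} {b : V ⇒ R} {a′ : V′ ⇒ F₀ R} {b′ : V′ ⇒ R} (x : V′ ⇒ V) →
                   a ∘ x ≈ a′ → b ∘ x ≈ b′ → Compatible α f a b → Compatible α f a′ b′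
    Compatible-∘ {a = a} {b} {a′} {b′} x ax bx c = begin
      F₁ f ∘ a′         ≈⟨ ∘-resp-≈ʳ (≈.sym ax) ⟩
      F₁ f ∘ a ∘ x      ≈⟨ pullˡ c ⟩
      (α ∘ f ∘ b) ∘ x   ≈⟨ ≈.trans assoc (∘-resp-≈ʳ assoc) ⟩
      α ∘ f ∘ b ∘ x     ≈⟨ ∘-resp-≈ʳ (∘-resp-≈ʳ bx) ⟩
      α ∘ f ∘ b′        ∎

    -- A converse to `Compatible-∘` along a cover; it brings compatibility down from a span to its
    -- image.
    Compatible-epi : ∀ {V V′} {a : V ⇒ F₀ R} {b : V ⇒ R} {a′ : V′ ⇒ F₀ R} {b′ : V′ ⇒ R}
                     {x : V′ ⇒ V} → RegularEpi {𝒞 = 𝒞} x →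
                     a ∘ x ≈ a′ → b ∘ x ≈ b′ → Compatible α f a′ b′ → Compatible α f a b
    Compatible-epi {a = a} {b} {a′} {b′} {x} re ax bx c = regularEpi⇒epi re (begin
      (F₁ f ∘ a) ∘ x    ≈⟨ ≈.trans assoc (∘-resp-≈ʳ ax) ⟩
      F₁ f ∘ a′         ≈⟨ c ⟩
      α ∘ f ∘ b′        ≈⟨ ∘-resp-≈ʳ (∘-resp-≈ʳ (≈.sym bx)) ⟩
      α ∘ f ∘ b ∘ x     ≈⟨ ≈.sym (≈.trans assoc (∘-resp-≈ʳ assoc)) ⟩
      (α ∘ f ∘ b) ∘ x   ∎)

    -- `F` preserves the commuting square, so neither side of the equation changes when the span
    -- over `P` is pushed to `T` instead of `R`.
    Compatible-square : ∀ {P T V} {μ : P ⇒ R} {t : T ⇒ X} {q : P ⇒ T} {a : V ⇒ F₀ P} {b : V ⇒ P} →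
                        t ∘ q ≈ f ∘ μ →
                        Compatible α f (F₁ μ ∘ a) (μ ∘ b) → Compatible α t (F₁ q ∘ a) (q ∘ b)
    Compatible-square {μ = μ} {t} {q} {a} {b} tq≈fμ c = begin
      F₁ t ∘ F₁ q ∘ a   ≈⟨ pullˡ F-tq≈fμ ⟩
      (F₁ f ∘ F₁ μ) ∘ a ≈⟨ assoc ⟩
      F₁ f ∘ F₁ μ ∘ a   ≈⟨ c ⟩
      α ∘ f ∘ μ ∘ b     ≈⟨ ∘-resp-≈ʳ (extendʳ (≈.sym tq≈fμ)) ⟩
      α ∘ t ∘ q ∘ b     ∎
      where
      F-tq≈fμ : F₁ t ∘ F₁ q ≈ F₁ f ∘ F₁ μ
      F-tq≈fμ = ≈.trans (≈.sym homomorphism) (≈.trans (F-resp-≈ tq≈fμ) homomorphism)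

  record AMSpan {X Y} (α : Coalgebra F X) (β : Coalgebra F Y) {R} (r : R ⇒ X × Y)
                : Set (o ⊔ ℓ ⊔ e) where
    field
      {V}         : Obj
      structure   : V ⇒ F₀ R
      cover       : V ⇒ R
      regularEpi  : RegularEpi {𝒞 = 𝒞} cover
      compatible₁ : Compatible α (π₁ ∘ r) structure cover
      compatible₂ : Compatible β (π₂ ∘ r) structure cover

  ×-jointlyMonic : ∀ {A B C} {g h : C ⇒ A × B} → π₁ ∘ g ≈ π₁ ∘ h → π₂ ∘ g ≈ π₂ ∘ h → g ≈ h
  ×-jointlyMonic p₁ p₂ = ≈.trans (≈.sym (unique p₁ p₂)) (unique ≈.refl ≈.refl)

  π₁-⁂ : ∀ {X Y R V} {α : Coalgebra F X} {β : Coalgebra F Y} {r : R ⇒ X × Y} {b : V ⇒ R} →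
         π₁ ∘ (α ⁂ β) ∘ r ∘ b ≈ α ∘ (π₁ ∘ r) ∘ b
  π₁-⁂ = ≈.trans (pullˡ project₁) (≈.trans assoc (∘-resp-≈ʳ (≈.sym assoc)))

  π₂-⁂ : ∀ {X Y R V} {α : Coalgebra F X} {β : Coalgebra F Y} {r : R ⇒ X × Y} {b : V ⇒ R} →
         π₂ ∘ (α ⁂ β) ∘ r ∘ b ≈ β ∘ (π₂ ∘ r) ∘ b
  π₂-⁂ = ≈.trans (pullˡ project₂) (≈.trans assoc (∘-resp-≈ʳ (≈.sym assoc)))

  module _ {X Y R V} {r : R ⇒ X × Y} {a : V ⇒ F₀ R} where

    π₁-⟨Fπ₁,Fπ₂⟩ : π₁ ∘ ⟨ F₁ π₁ , F₁ π₂ ⟩ ∘ F₁ r ∘ a ≈ F₁ (π₁ ∘ r) ∘ a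
    π₁-⟨Fπ₁,Fπ₂⟩ = ≈.trans (pullˡ project₁) (pullˡ (≈.sym homomorphism))

    π₂-⟨Fπ₁,Fπ₂⟩ : π₂ ∘ ⟨ F₁ π₁ , F₁ π₂ ⟩ ∘ F₁ r ∘ a ≈ F₁ (π₂ ∘ r) ∘ a
    π₂-⟨Fπ₁,Fπ₂⟩ = ≈.trans (pullˡ project₂) (pullˡ (≈.sym homomorphism))

  -- Passage between bisimulations and spans.

  module _ {X Y} {α : Coalgebra F X} {β : Coalgebra F Y} where

    bisimulation⇒span : {r : Relation X Y} →
                        IsRegularAMBisimulation F reg α β r → AMSpan α β (Subobject.arr r)
    bisimulation⇒span {r} bisim =
      let W , re , eq = bisim r ((id , identityʳ) , (id , identityʳ))
      in record
        { structure   = π₁ ∘ Subobject.arr W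
        ; cover       = π₂ ∘ Subobject.arr W
        ; regularEpi  = re
        ; compatible₁ = ≈.trans (≈.sym π₁-⟨Fπ₁,Fπ₂⟩) (≈.trans (∘-resp-≈ʳ (≈.sym eq)) π₁-⁂)
        ; compatible₂ = ≈.trans (≈.sym π₂-⟨Fπ₁,Fπ₂⟩) (≈.trans (∘-resp-≈ʳ (≈.sym eq)) π₂-⁂)
        }

    spans⇒bisimulation : {r : Relation X Y} →
                         ((m : Relation X Y) → m ≈ₛ r → AMSpan α β (Subobject.arr m)) →
                         IsRegularAMBisimulation F reg α β r
    spans⇒bisimulation spans m m≈r =
      record { arr = W.mono ; isMono = W.isMono }
      -- The cover factors as the second leg of the image after the epi `W.epi`, so that leg is
      -- itself a regular epi.
      , regularEpi-cancel (regularEpi⇒epi W.regularEpi) (≈.trans assoc π₂we≈b) regularEpi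
      , ×-jointlyMonic
          (≈.trans π₁-⁂ (≈.trans (≈.sym (on-image compatible₁)) (≈.sym π₁-⟨Fπ₁,Fπ₂⟩)))
          (≈.trans π₂-⁂ (≈.trans (≈.sym (on-image compatible₂)) (≈.sym π₂-⟨Fπ₁,Fπ₂⟩)))
      where
      open AMSpan (spans m m≈r)
      module W = RegularEpiMonoFactorisation (factorise ⟨ structure , cover ⟩)

      π₁we≈a : π₁ ∘ W.mono ∘ W.epi ≈ structure
      π₁we≈a = ≈.trans (∘-resp-≈ʳ W.factors) project₁

      π₂we≈b : π₂ ∘ W.mono ∘ W.epi ≈ cover
      π₂we≈b = ≈.trans (∘-resp-≈ʳ W.factors) project₂

      on-image : ∀ {A} {δ : Coalgebra F A} {f : Subobject.dom m ⇒ A} →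
                 Compatible δ f structure cover →
                 Compatible δ f (π₁ ∘ W.mono) (π₂ ∘ W.mono)
      on-image = Compatible-epi W.regularEpi (≈.trans assoc π₁we≈a) (≈.trans assoc π₂we≈b)

  -- Common covers and lifting along them.

  commonCover : ∀ {P R S V₁ V₂} {μ₁ : P ⇒ R} {μ₂ : P ⇒ S} {b₁ : V₁ ⇒ R} {b₂ : V₂ ⇒ S} →
                RegularEpi {𝒞 = 𝒞} b₁ → RegularEpi {𝒞 = 𝒞} b₂ →
                Σ[ V ∈ Obj ] Σ[ p ∈ V ⇒ P ] Σ[ x₁ ∈ V ⇒ V₁ ] Σ[ x₂ ∈ V ⇒ V₂ ]
                  (RegularEpi {𝒞 = 𝒞} p ∧ b₁ ∘ x₁ ≈ μ₁ ∘ p ∧ b₂ ∘ x₂ ≈ μ₂ ∘ p)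
  commonCover {μ₁ = μ₁} {μ₂} {b₁} {b₂} re₁ re₂ =
    -- `b₁` is pulled back along `μ₁`, then `b₂` along `μ₂` restricted to the cover of `P` just
    -- obtained.
    Q₂.P , Q₁.p₂ ∘ Q₂.p₂ , Q₁.p₁ ∘ Q₂.p₂ , Q₂.p₁
    , regularEpi-∘ reg (stable Q₁.isPullback re₁) (stable Q₂.isPullback re₂)
    , extendʳ Q₁.commute
    , ≈.trans Q₂.commute assoc
    where
    module Q₁ = Pullback (pullback b₁ μ₁)
    module Q₂ = Pullback (pullback b₂ (μ₂ ∘ Q₁.p₂))

  module _ (covers : CoversPullbacks F) {X Y Z} {f : X ⇒ Z} {g : Y ⇒ Z}
           {P} {p₁ : P ⇒ X} {p₂ : P ⇒ Y} (isPullback : IsPullback {𝒞 = 𝒞} p₁ p₂ f g) where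

    coverLift : ∀ {V} {a₁ : V ⇒ F₀ X} {a₂ : V ⇒ F₀ Y} → F₁ f ∘ a₁ ≈ F₁ g ∘ a₂ →
                Σ[ V′ ∈ Obj ] Σ[ v ∈ V′ ⇒ V ] Σ[ z ∈ V′ ⇒ F₀ P ]
                  (RegularEpi {𝒞 = 𝒞} v ∧ a₁ ∘ v ≈ F₁ p₁ ∘ z ∧ a₂ ∘ v ≈ F₁ p₂ ∘ z)
    coverLift {a₁ = a₁} {a₂} eq =
      Q.P , Q.p₂ , Q.p₁
      , stable Q.isPullback (covers isPullback R.isPullback c
                 (R.p₁∘universal F-commute) (R.p₂∘universal F-commute))
      , along (R.p₁∘universal eq) (R.p₁∘universal F-commute)
      , along (R.p₂∘universal eq) (R.p₂∘universal F-commute)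
      where
      module R = Pullback (pullback (F₁ f) (F₁ g))

      F-commute : F₁ f ∘ F₁ p₁ ≈ F₁ g ∘ F₁ p₂
      F-commute = ≈.trans (≈.sym homomorphism)
                    (≈.trans (F-resp-≈ (IsPullback.commute isPullback)) homomorphism)

      c : F₀ P ⇒ R.P
      c = R.universal F-commute

      module Q = Pullback (pullback c (R.universal eq))

      -- Composing the square of `Q` with a leg `h` of the pullback `R` gives the lifting equation
      -- for that leg.
      along : ∀ {A} {h : R.P ⇒ A} {a : _ ⇒ A} {k : F₀ P ⇒ A} →
              h ∘ R.universal eq ≈ a → h ∘ c ≈ k → a ∘ Q.p₂ ≈ k ∘ Q.p₁
      along {h = h} {a} {k} ha hc = begin
        a ∘ Q.p₂                   ≈⟨ pushˡ (≈.sym ha) ⟩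
        h ∘ R.universal eq ∘ Q.p₂  ≈⟨ ∘-resp-≈ʳ (≈.sym Q.commute) ⟩
        h ∘ c ∘ Q.p₁               ≈⟨ pullˡ hc ⟩
        k ∘ Q.p₁                   ∎

  -- The composite relation.

  module _ (covers : CoversPullbacks F) {X Y Z}
           {α : Coalgebra F X} {β : Coalgebra F Y} {γ : Coalgebra F Z} where

    -- Leaving `t` and `q` general, instead of fixing the chosen image factorisation, makes the
    -- construction apply to every representative of the composite.
    ⨾-span : ∀ {R S P T} {r : R ⇒ X × Y} {s : S ⇒ Y × Z} {t : T ⇒ X × Z}
             {μ₁ : P ⇒ R} {μ₂ : P ⇒ S} {q : P ⇒ T} →
             IsPullback {𝒞 = 𝒞} μ₁ μ₂ (π₂ ∘ r) (π₁ ∘ s) →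
             RegularEpi {𝒞 = 𝒞} q → t ∘ q ≈ ⟨ π₁ ∘ r ∘ μ₁ , π₂ ∘ s ∘ μ₂ ⟩ →
             AMSpan α β r → AMSpan β γ s → AMSpan α γ t
    ⨾-span {r = r} {s} {t} {μ₁} {μ₂} {q} isPullback req tq≈ σ τ =
      let V  , p , x , y , rep , bx≈μ₁p , by≈μ₂p = commonCover σ.regularEpi τ.regularEpi
          open IsPullback isPullback using (commute)
          over-FY = begin
            F₁ (π₂ ∘ r) ∘ σ.structure ∘ x  ≈⟨ Compatible-∘ x ≈.refl bx≈μ₁p σ.compatible₂ ⟩
            β ∘ (π₂ ∘ r) ∘ μ₁ ∘ p          ≈⟨ ∘-resp-≈ʳ (extendʳ commute) ⟩
            β ∘ (π₁ ∘ s) ∘ μ₂ ∘ p          ≈⟨ ≈.sym (Compatible-∘ y ≈.refl by≈μ₂p τ.compatible₁) ⟩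
            F₁ (π₁ ∘ s) ∘ τ.structure ∘ y  ∎
          V′ , v , z , rev , axv≈Fμ₁z , ayv≈Fμ₂z = coverLift covers isPullback over-FY
      in record
        { structure   = F₁ q ∘ z
        ; cover       = q ∘ p ∘ v
        ; regularEpi  = regularEpi-∘ reg req (regularEpi-∘ reg rep rev)
        -- Over `R`, the pair `F₁ μ₁ ∘ z`, `μ₁ ∘ p ∘ v` is the span `σ` restricted along `x ∘ v`, so
        -- compatibility with `α` is inherited; likewise for `τ` and `γ` below.
        ; compatible₁ = Compatible-square tq₁
            (Compatible-∘ (x ∘ v) (≈.trans (≈.sym assoc) axv≈Fμ₁z) (extendʳ bx≈μ₁p) σ.compatible₁)
        ; compatible₂ = Compatible-square tq₂
            (Compatible-∘ (y ∘ v) (≈.trans (≈.sym assoc) ayv≈Fμ₂z) (extendʳ by≈μ₂p) τ.compatible₂)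
        }
      where
      module σ = AMSpan σ
      module τ = AMSpan τ

      tq₁ : (π₁ ∘ t) ∘ q ≈ (π₁ ∘ r) ∘ μ₁
      tq₁ = ≈.trans assoc (≈.trans (∘-resp-≈ʳ tq≈) (≈.trans project₁ (≈.sym assoc)))

      tq₂ : (π₂ ∘ t) ∘ q ≈ (π₂ ∘ s) ∘ μ₂
      tq₂ = ≈.trans assoc (≈.trans (∘-resp-≈ʳ tq≈) (≈.trans project₂ (≈.sym assoc)))

    ⨾-bisimulation : {r : Relation X Y} {s : Relation Y Z} →
                     IsRegularAMBisimulation F reg α β r → IsRegularAMBisimulation F reg β γ s →
                     IsRegularAMBisimulation F reg α γ (r ⨾ s)
    ⨾-bisimulation {r} {s} br bs =
      -- For a representative `m`, the cover of its domain by the pullback is `k ∘ I.epi`, where `k`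
      -- compares `r ⨾ s` with `m`.
      spans⇒bisimulation {r = r ⨾ s} λ { m (m≤r⨾s , r⨾s≤m@(k , mk≈i)) →
      ⨾-span P.isPullback
        (regularEpi-≈ₛ {m = m} {r ⨾ s} r⨾s≤m m≤r⨾s I.regularEpi)
        (≈.trans (pullˡ mk≈i) I.factors)
        (bisimulation⇒span {r = r} br) (bisimulation⇒span {r = s} bs) }
      where
      module r = Subobject r
      module s = Subobject s
      -- `P` and `I` repeat the choices made in `_⨾_`, so `I.mono` is the arrow of `r ⨾ s` by
      -- definition.
      module P = Pullback (pullback (π₂ ∘ r.arr) (π₁ ∘ s.arr))
      module I = RegularEpiMonoFactorisation
                   (factorise ⟨ π₁ ∘ r.arr ∘ P.p₁ , π₂ ∘ s.arr ∘ P.p₂ ⟩)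

proposition2p16 : ∀ {o ℓ e} (𝒞 : Category o ℓ e) (reg : RegularCategory 𝒞) (F : Endofunctor 𝒞) →
    CoversPullbacks F →
    let open RegularCategory reg in
    ∀ {X Y Z : Category.Obj 𝒞}
    (α : Coalgebra F X) (β : Coalgebra F Y) (γ : Coalgebra F Z)
    (r : Relation X Y) (s : Relation Y Z) →
    IsRegularAMBisimulation F reg α β r →
    IsRegularAMBisimulation F reg β γ s →
    IsRegularAMBisimulation F reg α γ (r ⨾ s)
proposition2p16 𝒞 reg F covers α β γ r s =
    Bisimulations.⨾-bisimulation reg F covers {α = α} {β} {γ} {r} {s}
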